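{- Let $k\ge 1$ be an integer and let $\mathcal{D}$ be a finite dataset of vectors segmented into $S\ge 1$ pairwise disjoint subsets $\mathcal{D}_1,\mathcal{D}_2,\dots,\mathcal{D}_S$ (so $\mathcal{D}=\bigcup_{i=1}^S\mathcal{D}_i$). For a dataset $\mathcal{X}$ let $\mathbb{G}_k(\mathcal{X})$ denote the $k$ nearest neighbor graph of $\mathcal{X}$, and let $\mathbb{F}_k(\mathcal{D})$ denote the SIG-$k$NNG of $\mathcal{D}$ with respect to the segmentation $\mathcal{D}_1,\dots,\mathcal{D}_S$. Then $\mathbb{F}_k(\mathcal{D})$ is a segmented inclusive graph (with respect to the proximity graph construction $\mathcal{X}\mapsto\mathbb{G}_k(\mathcal{X})$). Specifically, for every $r$ with $1\le r\le S$ and any $r$ distinct integers $i_1,i_2,\dots,i_r$ chosen from $[1,S]$, we have $$\mathbb{G}_k(\mathcal{U})\subseteq \mathbb{F}_k(\mathcal{D}),\qquad \text{where } \mathcal{U}=\bigcup_{j=1}^{r}\mathcal{D}_{i_j}.$$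
   Context: $\Gamma(\cdot,\cdot)$ is a fixed real-valued distance function on vectors. For a vector $q$ and a finite set of vectors $\mathcal{X}$, $kNN(q,\mathcal{X})$ is the subset of $\mathcal{X}$ consisting of the $k$ nearest neighbors of $q$ in $\mathcal{X}$: if $|\mathcal{X}|<k$ then $kNN(q,\mathcal{X})=\mathcal{X}$; otherwise it is a $k$-element subset of $\mathcal{X}$ such that $\Gamma(o,q)<\Gamma(u,q)$ for all $o\in kNN(q,\mathcal{X})$ and all $u\in\mathcal{X}\setminus kNN(q,\mathcal{X})$. It is assumed that such a set exists (i.e., there are no ties in distance preventing it) for every $q$ and $\mathcal{X}$ for which $kNN(q,\mathcal{X})$ is used; it is then unique. $k$ nearest neighbor graph: $\mathbb{G}_k(\mathcal{X})$ is the directed graph with vertex set $\mathcal{X}$ and edge set $\{(v,o)\mid v\in\mathcal{X},\ o\in kNN(v,\mathcal{X}\setminus\{v\})\}$. SIG-$k$NNG: given $\mathcal{D}$ segmented into disjoint subsets $\mathcal{D}_1,\dots,\mathcal{D}_S$, $\mathbb{F}_k(\mathcal{D})=(V_{\mathbb{F}},E_{\mathbb{F}})$ is the directed graph with $V_{\mathbb{F}}=\mathcal{D}$ and $E_{\mathbb{F}}=\bigcup_{v\in\mathcal{D}}\bigcup_{i=1}^{S}E_i^k(v)$, where $E_i^k(v)=\{(v,o)\mid o\in kNN(v,\mathcal{D}_i\setminus\{v\})\}$. For graphs, $G\subseteq H$ means that $G$ is a sub-graph of $H$: the vertex set of $G$ is contained in that of $H$ and the edge set of $G$ is contained in that of $H$.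 Segmented inclusive graph: let $\mathbb{G}(\mathcal{X})$ denote a proximity graph constructed over a dataset $\mathcal{X}$, and let $\mathcal{D}$ be segmented into disjoint subsets $\mathcal{P}=\{\mathcal{D}_1,\dots,\mathcal{D}_S\}$. A graph $\mathbb{H}$ is a segmented inclusive graph for $\mathcal{D}$ if for all $r\in\{1,\dots,S\}$ and all $\mathcal{C}\in\mathcal{P}^{(r)}$ one has $\mathbb{G}\big(\bigcup_{e\in\mathcal{C}}e\big)\subseteq\mathbb{H}$, where $\mathcal{P}^{(r)}$ is the set of all combinations of $r$ elements of $\mathcal{P}$. -}

module Defs where

open import Data.Fin using (Fin)
open import Data.Fin.Subset using (Subset; _∈_; _∉_; _⊆_; ∣_∣; _-_; _∩_; ⊤; ⁅_⁆; ⋃; Empty; Nonempty)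
open import Data.Fin.Subset.Properties using (_∈?_; ∈⊤; p─q⊆p)
open import Data.List using (map; filter; tabulate; allFin)
open import Data.Nat as ℕ using (ℕ)
open import Data.Product using (∃; _×_; _,_)
open import Data.Rational as ℚ using (ℚ)
open import Data.Sum using (_⊎_)
open import Data.Vec using (Vec)
open import Data.Vec.Relation.Binary.Pointwise.Inductive using (Pointwise)
open import Function using (_⇔_)
open import Level using (0ℓ)
open import Relation.Binary using (Rel; _Preserves₂_⟶_⟶_)
open import Relation.Binary.PropositionalEquality using (_≡_; _≢_)
open import Relation.Nullary using (¬_)
open import Relation.Unary using (Pred)

-- Dedekind reals: two-sided, inhabited, rounded, disjoint, located cuts of ℚ.
record ℝ : Set₁ where
  field
    lower           : Pred ℚ 0ℓ
    upper           : Pred ℚ 0ℓ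
    lower-inhabited : ∃ lower
    upper-inhabited : ∃ upper
    lower-rounded   : ∀ q → lower q ⇔ (∃ λ r → q ℚ.< r × lower r)
    upper-rounded   : ∀ r → upper r ⇔ (∃ λ q → q ℚ.< r × upper q)
    disjoint        : ∀ q → ¬ (lower q × upper q)
    located         : ∀ q r → q ℚ.< r → lower q ⊎ upper r

open ℝ

infix 4 _≈_ _<_ _≈ᵛ_

_<_ : Rel ℝ 0ℓ
x < y = ∃ λ q → upper x q × lower y q

-- Distinct pairs of predicates can present the same cut, so equality of reals
-- is this relation and not _≡_.
_≈_ : Rel ℝ 0ℓ
x ≈ y = (∀ q → lower x q ⇔ lower y q) × (∀ q → upper x q ⇔ upper y q)

_≈ᵛ_ : {d : ℕ} → Vec ℝ d → Vec ℝ d → Set₁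
_≈ᵛ_ = Pointwise _≈_

-- No metric axioms: a distance function is any real-valued function of two
-- vectors (e.g. a negated inner product is allowed).
record DistanceFunction (d : ℕ) : Set₁ where
  field
    Γ      : Vec ℝ d → Vec ℝ d → ℝ
    Γ-cong : Γ Preserves₂ _≈ᵛ_ ⟶ _≈ᵛ_ ⟶ _≈_

-- A set of n vectors, enumerated without repetition.  Its members are referred
-- to by their index, so a subset of the dataset is a Subset n.
record Dataset (d n : ℕ) : Set₁ where
  field
    vector   : Fin n → Vec ℝ d
    distinct : ∀ i j → vector i ≈ᵛ vector j → i ≡ j

record Segmentation (S n : ℕ) : Set where
  field
    segment  : Fin S → Subset n
    disjoint : ∀ i j → i ≢ j → Empty (segment i ∩ segment j)
    covering : ⋃ (tabulate segment) ≡ ⊤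

-- The union of those segments whose index lies in C.
⋃[_]_ : {S n : ℕ} → Subset S → (Fin S → Subset n) → Subset n
⋃[ C ] segment = ⋃ (map segment (filter (_∈? C) (allFin _)))

record Digraph (n : ℕ) : Set₁ where
  field
    vertices : Subset n
    edge     : Rel (Fin n) 0ℓ
    incident : ∀ v o → edge v o → v ∈ vertices × o ∈ vertices

open Digraph

infix 4 _⊑_

_⊑_ : {n : ℕ} → Digraph n → Digraph n → Set
G ⊑ H = vertices G ⊆ vertices H × (∀ v o → edge G v o → edge H v o)

-- P⁽ʳ⁾ is represented by the r-element sets C of segment indices.
IsSegmentedInclusive : {S n : ℕ} → (Subset n → Digraph n) → (Fin S → Subset n) → Digraph n → Set
IsSegmentedInclusive {S} G segment H =
  ∀ r → 1 ℕ.≤ r → r ℕ.≤ S → (C : Subset S) → ∣ C ∣ ≡ r → G (⋃[ C ] segment) ⊑ H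

module NearestNeighbours {d n : ℕ} (distance : DistanceFunction d) (D : Dataset d n) (k : ℕ) where
  open DistanceFunction distance using (Γ)
  open Dataset D using (vector)

  -- Y = kNN(q, X)
  record IsKNN (q : Vec ℝ d) (X Y : Subset n) : Set where
    field
      subset : Y ⊆ X
      small  : ∣ X ∣ ℕ.< k → Y ≡ X
      size   : k ℕ.≤ ∣ X ∣ → ∣ Y ∣ ≡ k
      nearer : k ℕ.≤ ∣ X ∣ → ∀ o u → o ∈ Y → u ∈ X → u ∉ Y → Γ (vector o) q < Γ (vector u) q

  KNNExists : Vec ℝ d → Subset n → Set
  KNNExists q X = ∃ λ Y → IsKNN q X Y

  -- o ∈ kNN(q, X).  IsKNN determines Y uniquely, so this is membership in the
  -- set kNN(q, X) whenever KNNExists q X holds.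
  _∈kNN⟨_,_⟩ : Fin n → Vec ℝ d → Subset n → Set
  o ∈kNN⟨ q , X ⟩ = ∃ λ Y → IsKNN q X Y × o ∈ Y

  kNNG : Subset n → Digraph n
  kNNG X = record
    { vertices = X
    ; edge     = λ v o → v ∈ X × o ∈kNN⟨ vector v , X - v ⟩
    ; incident = λ { v o (v∈X , Y , isKNN , o∈Y) → v∈X , p─q⊆p X ⁅ v ⁆ (IsKNN.subset isKNN o∈Y) }
    }

  SIG-kNNG : {S : ℕ} → (Fin S → Subset n) → Digraph n
  SIG-kNNG segment = record
    { vertices = ⊤
    ; edge     = λ v o → ∃ λ i → o ∈kNN⟨ vector v , segment i - v ⟩
    ; incident = λ _ _ _ → ∈⊤ , ∈⊤
    }

  -- Ties never prevent the existence of the sets kNN(q, X) occurring in the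
  -- SIG-kNNG and in the kNNGs of the unions of segments.
  record NoTies {S : ℕ} (segment : Fin S → Subset n) : Set where
    field
      in-segments : ∀ v i → KNNExists (vector v) (segment i - v)
      in-unions   : ∀ C → Nonempty C → ∀ v → v ∈ ⋃[ C ] segment →
                    KNNExists (vector v) (⋃[ C ] segment - v)

{-# OPTIONS --safe #-}

-- A nearest neighbour o of v in X remains one in every X′ ⊆ X containing o.
-- Otherwise ∣X′∣ ≥ k and the k nearest neighbours of v in X′ are all strictly nearer to v
-- than o, so they lie among the k nearest neighbours of v in X; together with o
-- the latter would number at least k + 1.

module Submission where

open import Defs
open import Data.Fin using (Fin)
open import Data.Fin.Subset
  using (Subset; inside; outside; ⋃; _∈_; _∉_; _⊆_; _─_; ∣_∣; ⁅_⁆)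
open import Data.Fin.Subset.Properties
  using (_∈?_; ∈⊤; ∉⊥; x∈p∪q⁻; x∈p∪q⁺; p─q⊆p; x∈p∧x∉q⇒x∈p─q; p⊆q⇒∣p∣≤∣q∣; p⊂q⇒∣p∣<∣q∣)
open import Data.List using (List; []; _∷_; tabulate; allFin; filter)
open import Data.List.Relation.Unary.All as All using (All)
open import Data.List.Relation.Unary.All.Properties using (map⁺; tabulate⁺)
open import Data.List.Relation.Unary.Any as Any using ()
open import Data.List.Membership.Propositional using () renaming (_∈_ to _∈ˡ_)
open import Data.Nat using (ℕ; _≤_)
open import Data.Nat.Properties using (≤-trans; <-irrefl; ≮⇒≥) renaming (_<?_ to _<ℕ?_)
open import Data.Product using (∃; _×_; _,_)
open import Data.Rational as ℚ using (ℚ)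
open import Data.Rational.Properties using (<-cmp) renaming (<-asym to ℚ<-asym)
open import Data.Sum using (inj₁; inj₂)
open import Data.Vec using (_∷_; there)
open import Function using (_∘_; Equivalence)
open import Function.Definitions using (Injective)
open import Relation.Binary.Definitions using (Asymmetric; tri<; tri≈; tri>)
open import Relation.Binary.PropositionalEquality using (_≡_; refl; sym; trans; subst)
open import Relation.Nullary using (yes; no; contradiction; decidable-stable)

-- By trichotomy on ℚ: the other two cases would put a single rational in both halves of the cut.
lower-upper-< : (x : ℝ) {q r : ℚ} → ℝ.lower x q → ℝ.upper x r → q ℚ.< r
lower-upper-< x {q} {r} q∈lower r∈upper with <-cmp q r
... | tri< q<r _ _  = q<r
... | tri≈ _ refl _ = contradiction (q∈lower , r∈upper) (ℝ.disjoint x q)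
-- Roundedness makes the lower half downward closed, so `r` would lie in it as well.
... | tri> _ _ r<q  = contradiction
  (Equivalence.from (ℝ.lower-rounded x r) (q , r<q , q∈lower) , r∈upper) (ℝ.disjoint x r)

-- The rationals `q` and `r` witnessing the two inequalities are compared twice: the cut `x` gives
-- `r < q`, the cut `y` gives `q < r`.
<-asym : Asymmetric _<_
<-asym {x} {y} (q , q∈upperx , q∈lowery) (r , r∈uppery , r∈lowerx) =
  ℚ<-asym (lower-upper-< x r∈lowerx q∈upperx) (lower-upper-< y q∈lowery r∈uppery)

x∈p─q⇒x∉q : ∀ {n} {x : Fin n} (p q : Subset n) → x ∈ p ─ q → x ∉ q
-- Only tail positions remain: at the head, `inside` in `q` forces `outside` in the difference.
x∈p─q⇒x∉q (_ ∷ p) (outside ∷ q) (there x∈p─q) (there x∈q) = x∈p─q⇒x∉q p q x∈p─q x∈q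
x∈p─q⇒x∉q (_ ∷ p) (inside  ∷ q) (there x∈p─q) (there x∈q) = x∈p─q⇒x∉q p q x∈p─q x∈q

─-monoˡ-⊆ : ∀ {n} {p q : Subset n} (r : Subset n) → p ⊆ q → p ─ r ⊆ q ─ r
─-monoˡ-⊆ {p = p} r p⊆q x∈p─r =
  x∈p∧x∉q⇒x∈p─q (p⊆q (p─q⊆p p r x∈p─r)) (x∈p─q⇒x∉q p r x∈p─r)

x∈⋃⁻ : ∀ {n} {x : Fin n} (ps : List (Subset n)) → x ∈ ⋃ ps → ∃ λ p → p ∈ˡ ps × x ∈ p
x∈⋃⁻ []       x∈⊥ = contradiction x∈⊥ ∉⊥
x∈⋃⁻ (p ∷ ps) x∈p∪⋃ with x∈p∪q⁻ p (⋃ ps) x∈p∪⋃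
... | inj₁ x∈p = p , Any.here refl , x∈p
... | inj₂ x∈⋃ with x∈⋃⁻ ps x∈⋃
...   | q , q∈ps , x∈q = q , Any.there q∈ps , x∈q

p∈ps⇒p⊆⋃ps : ∀ {n} {p : Subset n} {ps : List (Subset n)} → p ∈ˡ ps → p ⊆ ⋃ ps
p∈ps⇒p⊆⋃ps (Any.here refl)  = x∈p∪q⁺ ∘ inj₁
p∈ps⇒p⊆⋃ps (Any.there p∈ps) = x∈p∪q⁺ ∘ inj₂ ∘ p∈ps⇒p⊆⋃ps p∈ps

module _ {d n k : ℕ} (distance : DistanceFunction d) (D : Dataset d n) where
  open NearestNeighbours distance D k
  open DistanceFunction distance using (Γ)
  open Dataset D using (vector)

  IsKNN-⊆ : ∀ {q X X′ Y Y′ o} → X′ ⊆ X → IsKNN q X Y → IsKNN q X′ Y′ →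
            o ∈ Y → o ∈ X′ → o ∈ Y′
  IsKNN-⊆ {q} {X} {X′} {Y} {Y′} {o} X′⊆X knn knn′ o∈Y o∈X′ with ∣ X′ ∣ <ℕ? k
  ... | yes ∣X′∣<k = subst (o ∈_) (sym (IsKNN.small knn′ ∣X′∣<k)) o∈X′
  ... | no  ∣X′∣≮k = decidable-stable (o ∈? Y′) λ o∉Y′ →
    -- Both neighbour sets have exactly `k` elements, yet `o` makes the inclusion of `Y′` in `Y`
    -- strict.
    <-irrefl (trans (IsKNN.size knn′ k≤∣X′∣) (sym (IsKNN.size knn k≤∣X∣)))
      (p⊂q⇒∣p∣<∣q∣ (Y′⊆Y o∉Y′ , o , o∈Y , o∉Y′))
    where
    k≤∣X′∣ : k ≤ ∣ X′ ∣
    k≤∣X′∣ = ≮⇒≥ ∣X′∣≮k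

    k≤∣X∣ : k ≤ ∣ X ∣
    k≤∣X∣ = ≤-trans k≤∣X′∣ (p⊆q⇒∣p∣≤∣q∣ X′⊆X)

    Y′⊆Y : o ∉ Y′ → Y′ ⊆ Y
    Y′⊆Y o∉Y′ {y} y∈Y′ = decidable-stable (y ∈? Y) λ y∉Y →
      -- Seen from `X`, `o` is chosen and `y` is not; seen from `X′`, it is the reverse.
      <-asym {Γ (vector o) q} {Γ (vector y) q}
        (IsKNN.nearer knn k≤∣X∣ o y o∈Y (X′⊆X (IsKNN.subset knn′ y∈Y′)) y∉Y)
        (IsKNN.nearer knn′ k≤∣X′∣ y o y∈Y′ o∈X′ o∉Y′)

  -- Formulated for a list of segments because unions over a set of indices and over a tuple of
  -- indices both unfold to `⋃` of such a list.
  kNNG-⋃⊑SIG-kNNG : ∀ {S} {segment : Fin S → Subset n} → NoTies segment →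
                    ∀ {ps} → All (λ p → ∃ λ i → p ≡ segment i) ps →
                    kNNG (⋃ ps) ⊑ SIG-kNNG segment
  kNNG-⋃⊑SIG-kNNG {segment = segment} noTies {ps} segments = (λ _ → ∈⊤) , edge⊆
    where
    edge⊆ : ∀ v o → Digraph.edge (kNNG (⋃ ps)) v o → Digraph.edge (SIG-kNNG segment) v o
    edge⊆ v o (_ , Y , knn , o∈Y)
      with o∈⋃-v ← IsKNN.subset knn o∈Y
      -- The segment to use is one containing the head `o` of the edge; the tail `v` may lie in
      -- another.
      with p , p∈ps , o∈p ← x∈⋃⁻ ps (p─q⊆p (⋃ ps) ⁅ v ⁆ o∈⋃-v)
      with i , refl ← All.lookup segments p∈ps
      with Y′ , knn′ ← NoTies.in-segments noTies v i
      = i , Y′ , knn′ ,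
        -- The search set shrinks from the union without `v` to segment `i` without `v`, which still
        -- contains `o`.
        IsKNN-⊆ (─-monoˡ-⊆ ⁅ v ⁆ (p∈ps⇒p⊆⋃ps p∈ps)) knn knn′ o∈Y
          (x∈p∧x∉q⇒x∈p─q o∈p (x∈p─q⇒x∉q (⋃ ps) ⁅ v ⁆ o∈⋃-v))

theorem1 : (d n k S : ℕ) → 1 ≤ k → 1 ≤ S →
    (distance : DistanceFunction d) (D : Dataset d n) (P : Segmentation S n) →
    let open NearestNeighbours distance D k
        open Segmentation P using (segment) in
    NoTies segment →
    IsSegmentedInclusive kNNG segment (SIG-kNNG segment) ×
    (∀ r → 1 ≤ r → r ≤ S → (i : Fin r → Fin S) → Injective _≡_ _≡_ i →
      kNNG (⋃ (tabulate (segment ∘ i))) ⊑ SIG-kNNG segment)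
theorem1 d n k S _ _ distance D P noTies =
  (λ _ _ _ C _ → kNNG-⋃⊑SIG-kNNG distance D noTies
    (map⁺ (All.universal (λ i → i , refl) (filter (_∈? C) (allFin S))))) ,
  (λ _ _ _ i _ → kNNG-⋃⊑SIG-kNNG distance D noTies (tabulate⁺ (λ j → i j , refl)))
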